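{- For every finite simple undirected graph $G$, the clean-factor series $(G_i)_{i\ge 1}$ generated by $G$ terminates; that is, there is some $i\ge 1$ such that $G_i$ is defined and the clean-factor factorisation of $G_i$ is not effective (it creates no new vertex).
   Context: All graphs are finite, undirected and simple. A $k$-partite graph $G=(V_0,\ldots,V_{k-1},E)$ is a graph together with an ordered partition $(V_0,\ldots,V_{k-1})$ of its vertex set into $k$ non-empty parts (levels) such that every edge joins vertices in different parts. $N(x)$ is the neighbourhood of $x$ and $N_i(x)=N(x)\cap V_i$. Factorisation. Given a $k$-partite graph $G=(V_0,\ldots,V_{k-1},E)$ with $k\ge 2$ and a set $V'_k$ of subsets of $V(G)$, the factorisation of $G$ with respect to $V'_k$ is the graph $G'=(V_0,\ldots,V_k,E\cup E_+)$, where the new level $V_k$ is the set of inclusion-maximal elements of $V'_k$ and $E_+=\{Xy \mid X\in V_k,\ y\in X\}$. It is called effective if $V_k\neq\emptyset$. The set $V^+_k$. For a $k$-partite graph, $V^+_k$ is the set of all sets $\{x_1,\ldots,x_l\}\cup\bigcap_{1\le i\le l}N(x_i)$ where $l\ge 2$, $x_1,\ldots,x_l$ are distinct elements of $V_{k-1}$, and $|\bigcap_{1\le i\le l}N(x_i)|\ge 2$. The set $V^*_k$. - If $k\ge 5$: $V^*_k$ is the set of $X\in V^+_k$ such that $|\bigcap_{x\in X\cap V_{k-1}}N_{k-2}(x)|\ge 2$, and $N_{k-3}(x)=N_{k-3}(y)$ for all $x,y\in X\cap V_{k-1}$, and $|\bigcap_{x\in X\cap V_{k-1}}N_1(x)|\ge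 2$. - If $k=4$: $V^*_4$ is the set of $X\in V^+_4$ such that $|\bigcap_{x\in X\cap V_3}N_2(x)|\ge 2$, $|\bigcap_{x\in X\cap V_3}N_1(x)|\ge 2$, and $N_0(x)=N_0(y)$ for all $x,y\in X\cap V_3$. - If $k=3$: $V^*_3$ is the set of $X\in V^+_3$ such that $|\bigcap_{x\in X\cap V_2}N_1(x)|\ge 2$ and $|\bigcap_{x\in X\cap V_2}N_0(x)|\ge 2$. - If $k=2$: $V^*_2=V^+_2$. The clean-factor graph of a $k$-partite graph is its factorisation with respect to $V^*_k$. Clean-factor series of a graph $G$. $\mathcal{K}(G)$ is the set of maximal cliques of $G$. $G_1=B(G)$ is the vertex-clique-incidence bipartite graph: level $V_0=V(G)$, level $V_1=\mathcal{K}(G)$, with an edge $vC$ whenever $v\in C$. For $i\ge 1$, $G_{i+1}$ is the clean-factor graph of $G_i$ if that factorisation is effective, and is undefined otherwise (as are then all subsequent graphs). -}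

module Defs where

import Data.Bool.Properties as Bool
open import Data.Empty using (⊥; ⊥-elim)
open import Data.Fin.Base using (Fin; zero; suc; toℕ; fromℕ; inject₁; splitAt; _↑ˡ_; _↑ʳ_)
open import Data.Fin.Properties
  using (all?; fromℕ≢inject₁; splitAt-↑ˡ; splitAt-↑ʳ)
import Data.Fin.Properties as Fin
open import Data.Fin.Relation.Unary.Top using (view; ‵fromℕ; ‵inject₁)
open import Data.Fin.Subset using (Subset; inside; outside; _∈_; _⊂_; _∩_; _∪_; ∣_∣)
  renaming (⊥ to ∅)
open import Data.Fin.Subset.Properties
  using (_∈?_; _⊂?_; anySubset?; ∣p∣≤n; p⊂q⇒∣p∣<∣q∣; ∉⊥)
open import Data.List.Base using (List; []; _∷_; _++_; map; filter; length; lookup)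
import Data.List.Membership.Propositional as List
open import Data.List.Membership.Propositional.Properties
  using (∈-map⁺; ∈-map⁻; ∈-++⁺ˡ; ∈-++⁺ʳ; ∈-filter⁺)
open import Data.List.Relation.Unary.All using ([])
open import Data.List.Relation.Unary.Any using (here)
open import Data.List.Relation.Unary.Unique.Propositional using (Unique; []; _∷_)
import Data.List.Relation.Unary.Unique.Propositional.Properties as Unique
open import Data.Maybe.Base using (Maybe; just; nothing; when; _>>=_)
open import Data.Nat.Base using (ℕ; zero; suc; _+_; _∸_; _≤_; _<_)
open import Data.Nat.Properties using (_≤?_; ∸-monoʳ-<)
import Data.Nat.Properties as ℕ
open import Data.Nat.Induction using (<-wellFounded)
open import Data.Product.Base using (∃; ∃-syntax; _×_; _,_)
open import Data.Sum.Base using (_⊎_; inj₁; inj₂)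
open import Data.Unit.Base using (⊤; tt)
open import Data.Vec.Base using ([]; _∷_; tabulate)
open import Data.Vec.Properties using (≡-dec; ∷-injectiveʳ)
open import Function.Base using (_∘_; case_of_)
open import Induction.WellFounded using (Acc; acc)
open import Level using (0ℓ)
open import Relation.Binary.Core using (Rel)
open import Relation.Binary.Definitions using (Symmetric; Irreflexive; DecidableEquality)
  renaming (Decidable to Decidable₂)
open import Relation.Binary.PropositionalEquality
  using (_≡_; _≢_; refl; sym; trans; cong; subst)
open import Relation.Nullary.Decidable
  using (Dec; yes; no; does; ¬?; _×-dec_; _→-dec_)
open import Relation.Nullary.Negation using (¬_; contradiction)
open import Relation.Unary using (Pred; Decidable)

private
  variable
    k n : ℕ

-- Set comprehension in Fin n.
⟪_⟫ : {P : Pred (Fin n) 0ℓ} → Decidable P → Subset n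
⟪ P? ⟫ = tabulate (does ∘ P?)

-- The intersection of F x over all x ∈ S (which is everything if S is empty).
⋂[_] : Subset n → (Fin n → Subset n) → Subset n
⋂[ S ] F = ⟪ (λ y → all? (λ x → x ∈? S →-dec y ∈? F x)) ⟫

infix 4 _≟ˢ_

_≟ˢ_ : DecidableEquality (Subset n)
_≟ˢ_ = ≡-dec Bool._≟_

allSubsets : ∀ n → List (Subset n)
allSubsets zero    = [] ∷ []
allSubsets (suc n) = map (outside ∷_) (allSubsets n) ++ map (inside ∷_) (allSubsets n)

Maximal : Pred (Subset n) 0ℓ → Pred (Subset n) 0ℓ
Maximal P X = P X × ¬ (∃[ Y ] P Y × X ⊂ Y)

maximal? : {P : Pred (Subset n) 0ℓ} → Decidable P → Decidable (Maximal P)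
maximal? P? X = P? X ×-dec ¬? (anySubset? (λ Y → P? Y ×-dec X ⊂? Y))

maximals : {P : Pred (Subset n) 0ℓ} → Decidable P → List (Subset n)
maximals P? = filter (maximal? P?) (allSubsets _)

exists-maximal : {P : Pred (Subset n) 0ℓ} (P? : Decidable P) → ∃ P → ∃ (Maximal P)
exists-maximal {n} {P} P? (X , p) = go X p (<-wellFounded (n ∸ ∣ X ∣))
  where
  go : ∀ X → P X → Acc _<_ (n ∸ ∣ X ∣) → ∃ (Maximal P)
  go X p (acc rec) with anySubset? (λ Y → P? Y ×-dec X ⊂? Y)
  ... | no  ¬bigger        = X , p , ¬bigger
  ... | yes (Y , q , X⊂Y) = go Y q (rec (∸-monoʳ-< (p⊂q⇒∣p∣<∣q∣ X⊂Y) (∣p∣≤n Y)))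

∈-allSubsets : (X : Subset n) → X List.∈ allSubsets n
∈-allSubsets []            = here refl
∈-allSubsets (outside ∷ X) = ∈-++⁺ˡ (∈-map⁺ (outside ∷_) (∈-allSubsets X))
∈-allSubsets (inside  ∷ X) =
  ∈-++⁺ʳ (map (outside ∷_) (allSubsets _)) (∈-map⁺ (inside ∷_) (∈-allSubsets X))

allSubsets-unique : ∀ n → Unique (allSubsets n)
allSubsets-unique zero    = [] ∷ []
allSubsets-unique (suc n) =
  Unique.++⁺ (Unique.map⁺ ∷-injectiveʳ (allSubsets-unique n))
             (Unique.map⁺ ∷-injectiveʳ (allSubsets-unique n))
             λ { (p , q) → case (∈-map⁻ (outside ∷_) p , ∈-map⁻ (inside ∷_) q) of
                             λ { ((_ , _ , refl) , (_ , _ , ())) } }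

maximals-unique : {P : Pred (Subset n) 0ℓ} (P? : Decidable P) → Unique (maximals P?)
maximals-unique P? = Unique.filter⁺ (maximal? P?) (allSubsets-unique _)

maximals≢[] : {P : Pred (Subset n) 0ℓ} (P? : Decidable P) → ∃ P → maximals P? ≢ []
maximals≢[] P? ∃P eq with X , max ← exists-maximal P? ∃P
  with () ← subst (X List.∈_) eq (∈-filter⁺ (maximal? P?) (∈-allSubsets X) max)

-- Adjacency is required to be decidable, as it classically is; this is what
-- makes the vertex sets of all graphs of the series explicitly enumerable.
record Graph (n : ℕ) : Set₁ where
  infix 4 _~_ _~?_
  field
    _~_     : Rel (Fin n) 0ℓ
    _~?_    : Decidable₂ _~_
    ~-sym   : Symmetric _~_
    ~-irrefl : Irreflexive _≡_ _~_

-- Non-emptiness of the parts is the separate predicate NonEmptyParts: it is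
-- automatic in the clean-factor series of a graph with at least one vertex
-- (cleanFactorSeries-nonEmptyParts), while the incidence graph of the graph
-- without vertices has an empty level V 0.
record Partite (k : ℕ) : Set₁ where
  infix 4 _~_ _~?_
  field
    order   : ℕ
    level   : Fin order → Fin k
    _~_     : Rel (Fin order) 0ℓ
    _~?_    : Decidable₂ _~_
    ~-sym   : Symmetric _~_
    ~-level : ∀ {x y} → x ~ y → level x ≢ level y

  V : ℕ → Subset order
  V i = ⟪ (λ x → toℕ (level x) ℕ.≟ i) ⟫

  N : Fin order → Subset order
  N x = ⟪ x ~?_ ⟫

  N[_] : ℕ → Fin order → Subset order
  N[ i ] x = N x ∩ V i

open Partite

NonEmptyParts : Partite k → Set
NonEmptyParts H = ∀ i → ∃[ x ] level H x ≡ i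

-- The vertices of H come first, followed by one vertex for each member of the
-- list Xs, which is joined to exactly its elements.
module AddLevel (H : Partite k) (Xs : List (Subset (order H))) where

  Vertex : Set
  Vertex = Fin (order H) ⊎ Fin (length Xs)

  split : Fin (order H + length Xs) → Vertex
  split = splitAt (order H)

  levelᵥ : Vertex → Fin (suc k)
  levelᵥ (inj₁ x) = inject₁ (level H x)
  levelᵥ (inj₂ _) = fromℕ k

  Adj : Rel Vertex 0ℓ
  Adj (inj₁ x) (inj₁ y) = _~_ H x y
  Adj (inj₁ y) (inj₂ j) = y ∈ lookup Xs j
  Adj (inj₂ j) (inj₁ y) = y ∈ lookup Xs j
  Adj (inj₂ _) (inj₂ _) = ⊥

  adj? : Decidable₂ Adj
  adj? (inj₁ x) (inj₁ y) = _~?_ H x y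
  adj? (inj₁ y) (inj₂ j) = y ∈? lookup Xs j
  adj? (inj₂ j) (inj₁ y) = y ∈? lookup Xs j
  adj? (inj₂ _) (inj₂ _) = no λ ()

  adj-sym : Symmetric Adj
  adj-sym {inj₁ _} {inj₁ _} = ~-sym H
  adj-sym {inj₁ _} {inj₂ _} y∈X = y∈X
  adj-sym {inj₂ _} {inj₁ _} y∈X = y∈X

  adj-level : ∀ u v → Adj u v → levelᵥ u ≢ levelᵥ v
  adj-level (inj₁ x) (inj₁ y) x~y = ~-level H x~y ∘ Fin.inject₁-injective
  adj-level (inj₁ _) (inj₂ _) _   = fromℕ≢inject₁ ∘ sym
  adj-level (inj₂ _) (inj₁ _) _   = fromℕ≢inject₁

  addLevel : Partite (suc k)
  addLevel = record
    { order   = order H + length Xs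
    ; level   = levelᵥ ∘ split
    ; _~_     = λ u v → Adj (split u) (split v)
    ; _~?_    = λ u v → adj? (split u) (split v)
    ; ~-sym   = λ {u} {v} → adj-sym {split u} {split v}
    ; ~-level = λ {u} {v} → adj-level (split u) (split v)
    }

  addLevel-nonEmptyParts : NonEmptyParts H → Xs ≢ [] → NonEmptyParts addLevel
  addLevel-nonEmptyParts ne Xs≢[] i with view i
  ... | ‵inject₁ i′ with x , eq ← ne i′ =
    x ↑ˡ length Xs , trans (cong levelᵥ (splitAt-↑ˡ (order H) x _)) (cong inject₁ eq)
  ... | ‵fromℕ =
    order H ↑ʳ j , cong levelᵥ (splitAt-↑ʳ (order H) _ j)
    where
    index : ∀ (Ys : List (Subset (order H))) → Ys ≢ [] → Fin (length Ys)
    index []      ne = contradiction refl ne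
    index (_ ∷ _) _  = zero
    j = index Xs Xs≢[]

open AddLevel public using (addLevel; addLevel-nonEmptyParts)

module _ (H : Partite k) {V′ : Pred (Subset (order H)) 0ℓ} (V′? : Decidable V′) where

  factorisation : Partite (suc k)
  factorisation = addLevel H (maximals V′?)

  Effective : Set
  Effective = maximals V′? ≢ []

  effective? : Dec Effective
  effective? with maximals V′?
  ... | []    = no λ ne → ne refl
  ... | _ ∷ _ = yes λ ()

-- The index of k-partite graphs below is written as k = 2 + j, so that the
-- last level V_{k-1} is V (1 + j).
module _ {j : ℕ} (H : Partite (2 + j)) where

  -- S is the set {x₁ , … , xₗ}.
  V⁺ : Pred (Subset (order H)) 0ℓ
  V⁺ X = ∃[ S ] (∀ x → x ∈ S → x ∈ V H (1 + j))
              × 2 ≤ ∣ S ∣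
              × 2 ≤ ∣ ⋂[ S ] (N H) ∣
              × X ≡ S ∪ ⋂[ S ] (N H)

  V⁺? : Decidable V⁺
  V⁺? X = anySubset? λ S → all? (λ x → x ∈? S →-dec x ∈? V H (1 + j))
                   ×-dec 2 ≤? ∣ S ∣
                   ×-dec 2 ≤? ∣ ⋂[ S ] (N H) ∣
                   ×-dec X ≟ˢ S ∪ ⋂[ S ] (N H)

  TwoCommon : ℕ → Pred (Subset (order H)) 0ℓ
  TwoCommon i T = 2 ≤ ∣ ⋂[ T ] (N[_] H i) ∣

  twoCommon? : ∀ i → Decidable (TwoCommon i)
  twoCommon? i T = 2 ≤? ∣ ⋂[ T ] (N[_] H i) ∣

  SameN : ℕ → Pred (Subset (order H)) 0ℓ
  SameN i T = ∀ x y → x ∈ T → y ∈ T → N[_] H i x ≡ N[_] H i y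

  sameN? : ∀ i → Decidable (SameN i)
  sameN? i T = all? λ x → all? λ y →
    x ∈? T →-dec y ∈? T →-dec N[_] H i x ≟ˢ N[_] H i y

-- The part of the definition of V* that concerns T = X ∩ V_{k-1}; in the last
-- clause, which covers all k ≥ 5, j is k - 2 and j ∸ 1 is k - 3.
Clean : ∀ {j} (H : Partite (2 + j)) → Pred (Subset (order H)) 0ℓ
Clean {0}                     H T = ⊤
Clean {1}                     H T = TwoCommon H 1 T × TwoCommon H 0 T
Clean {2}                     H T = TwoCommon H 2 T × TwoCommon H 1 T × SameN H 0 T
Clean {j@(suc (suc (suc _)))} H T = TwoCommon H j T × SameN H (j ∸ 1) T × TwoCommon H 1 T

clean? : ∀ {j} (H : Partite (2 + j)) → Decidable (Clean H)
clean? {0}                     H T = yes tt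
clean? {1}                     H T = twoCommon? H 1 T ×-dec twoCommon? H 0 T
clean? {2}                     H T = twoCommon? H 2 T ×-dec twoCommon? H 1 T ×-dec sameN? H 0 T
clean? {j@(suc (suc (suc _)))} H T =
  twoCommon? H j T ×-dec sameN? H (j ∸ 1) T ×-dec twoCommon? H 1 T

module _ {j : ℕ} (H : Partite (2 + j)) where

  V* : Pred (Subset (order H)) 0ℓ
  V* X = V⁺ H X × Clean H (X ∩ V H (1 + j))

  V*? : Decidable V*
  V*? X = V⁺? H X ×-dec clean? H (X ∩ V H (1 + j))

  cleanFactor : Partite (3 + j)
  cleanFactor = factorisation H V*?

  CleanFactorEffective : Set
  CleanFactorEffective = Effective H V*?

  cleanFactorEffective? : Dec CleanFactorEffective
  cleanFactorEffective? = effective? H V*?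

  nextGraph : Maybe (Partite (3 + j))
  nextGraph = when (does cleanFactorEffective?) cleanFactor

module _ (G : Graph n) where
  private module G = Graph G

  Clique : Pred (Subset n) 0ℓ
  Clique C = ∀ x y → x ∈ C → y ∈ C → x ≢ y → x G.~ y

  clique? : Decidable Clique
  clique? C = all? λ x → all? λ y →
    x ∈? C →-dec y ∈? C →-dec ¬? (x Fin.≟ y) →-dec x G.~? y

  -- The vertices of G as a single level without edges.
  vertexLevel : Partite 1
  vertexLevel = record
    { order   = n
    ; level   = λ _ → zero
    ; _~_     = λ _ _ → ⊥
    ; _~?_    = λ _ _ → no λ ()
    ; ~-sym   = λ ()
    ; ~-level = λ ()
    }

  -- The vertex-clique-incidence graph B(G).
  incidence : Partite 2
  incidence = addLevel vertexLevel (maximals clique?)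

  -- The graph Gᵢ, which is (1 + i)-partite; the series starts at i = 1.
  cleanFactorSeries : ∀ i → Maybe (Partite (1 + i))
  cleanFactorSeries 0             = nothing
  cleanFactorSeries 1             = just incidence
  cleanFactorSeries (suc (suc i)) = cleanFactorSeries (suc i) >>= nextGraph

incidence-nonEmptyParts : (G : Graph (suc n)) → NonEmptyParts (incidence G)
incidence-nonEmptyParts G = addLevel-nonEmptyParts (vertexLevel G) _
  (λ { zero → zero , refl })
  (maximals≢[] (clique? G) (∅ , λ _ _ x∈∅ → ⊥-elim (∉⊥ x∈∅)))

nextGraph-nonEmptyParts : ∀ {j} (H : Partite (2 + j)) {K} →
  NonEmptyParts H → nextGraph H ≡ just K → NonEmptyParts K
nextGraph-nonEmptyParts H ne eq with cleanFactorEffective? H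
... | yes eff with refl ← eq = addLevel-nonEmptyParts H _ ne eff

cleanFactorSeries-nonEmptyParts : (G : Graph (suc n)) → ∀ i {H} →
  cleanFactorSeries G i ≡ just H → NonEmptyParts H
cleanFactorSeries-nonEmptyParts G 1 refl = incidence-nonEmptyParts G
cleanFactorSeries-nonEmptyParts G (suc (suc i)) eq
  with cleanFactorSeries G (suc i) | cleanFactorSeries-nonEmptyParts G (suc i)
... | just H | ne = nextGraph-nonEmptyParts H (ne refl) eq

{-# OPTIONS --safe #-}

-- Write 𝓕 for the sets that are intersections of at least two maximal cliques
-- and have at least two vertices. The vertices of level V_{i+1} (i ≥ 1) of the
-- series correspond bijectively to the chains A₁ ⊂ A₂ ⊂ ⋯ ⊂ Aᵢ in 𝓕, in such a
-- way that the neighbours of this chain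
--   in V_0 are the elements of A₁,
--   in V_1 are the maximal cliques containing Aᵢ,
--   in V_{j+1} (1 ≤ j < i) are the chains A₁ ⊂ ⋯ ⊂ A_{j-1} ⊂ D with A_j ⊆ D ⊆ A_{j+1}.
-- Indeed, cleanness forces the chains of X ∩ V_{k-1} to differ only in their last
-- sets D, and X then yields a chain by replacing D with ⋂ D ⊂ closure (⋃ D).
-- A chain of sets of vertices of G has bounded length, so the series terminates.

module Submission where

open import Defs
open import Data.Fin.Base using (Fin; zero; suc; toℕ; join)
open import Data.Fin.Properties
  using (all?; toℕ<n; toℕ-fromℕ; toℕ-inject₁; splitAt-join; join-splitAt; ¬∀⟶∃¬)
open import Data.Fin.Subset
  using (Subset; inside; outside; Nonempty; ⁅_⁆; _∈_; _⊆_; _⊂_; _∩_; _∪_; ∣_∣)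
open import Data.Fin.Subset.Properties
  using ( _∈?_; _⊆?_; ⊆-refl; ⊆-reflexive; ⊆-trans; ⊆-antisym; ⊂-⊆-trans; ⊂-trans; ⊂-irref
        ; p⊂q⇒∣p∣<∣q∣; p⊆q⇒∣p∣≤∣q∣; ∣p∣≤n; ∣⊥∣≡0; nonempty?; Empty-unique
        ; x∈p∩q⁺; x∈p∩q⁻; x∈p∪q⁺; x∈p∪q⁻; x∈p⇒∣p-x∣<∣p∣; x∈p∧x≢y⇒x∈p-y )
open import Data.List.Base using (List; []; _∷_; length; lookup)
import Data.List.Membership.Propositional as List
open import Data.List.Membership.Propositional.Properties using (∈-lookup; ∈-filter⁺; ∈-filter⁻)
open import Data.List.Properties using () renaming (≡-dec to ≡ˡ-dec)
import Data.List.Relation.Unary.All as All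
open import Data.List.Relation.Unary.Any as Any using (index)
open import Data.List.Relation.Unary.Any.Properties using (lookup-index)
open import Data.List.Relation.Unary.Unique.Propositional using (Unique; []; _∷_)
open import Data.Maybe.Base using (just; when; _>>=_)
open import Data.Nat.Base using (ℕ; zero; suc; _+_; _≤_; _<_; z≤n; s≤s; s≤s⁻¹)
open import Data.Nat.Properties
  using ( ≤-refl; ≤-reflexive; ≤-trans; <-≤-trans; <-irrefl; <-asym; <⇒≤; <⇒≢; ≤∧≢⇒<; ≤⇒≯
        ; n≤1+n; m≤n⇒m≤1+n; m≤m+n; suc-injective; +-suc )
import Data.Nat.Properties as ℕ
open import Data.Product.Base using (∃; Σ-syntax; ∃-syntax; _×_; _,_; proj₁; proj₂)
open import Data.Sum.Base using (_⊎_; inj₁; inj₂)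
open import Data.Vec.Base using ([]; _∷_; here; there)
open import Data.Vec.Properties using (lookup∘tabulate; lookup⇒[]=; []=⇒lookup)
open import Function.Base using (_∘_; case_of_)
open import Level using (0ℓ)
open import Relation.Binary.Definitions using () renaming (Decidable to Decidable₂)
open import Relation.Binary.PropositionalEquality
  using (_≡_; _≢_; refl; sym; trans; cong; cong₂; subst)
open import Relation.Nullary.Decidable
  using (Dec; yes; no; does; map′; dec-true; _×-dec_; _⊎-dec_; _→-dec_)
open import Relation.Nullary.Negation using (¬_; contradiction)
open import Relation.Unary using (Pred; Decidable)

open Partite

private
  variable
    i j k m n : ℕ

-- Finite subsets, intersections and maximal elements.

∈⟪⟫⁺ : {P : Pred (Fin n) 0ℓ} (P? : Decidable P) → ∀ {x} → P x → x ∈ ⟪ P? ⟫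
∈⟪⟫⁺ P? {x} px = lookup⇒[]= x _ (trans (lookup∘tabulate _ x) (dec-true (P? x) px))

∈⟪⟫⁻ : {P : Pred (Fin n) 0ℓ} (P? : Decidable P) → ∀ {x} → x ∈ ⟪ P? ⟫ → P x
∈⟪⟫⁻ P? {x} x∈ with P? x | trans (sym (lookup∘tabulate (does ∘ P?) x)) ([]=⇒lookup x∈)
... | yes px | _ = px

-- The index set may live in another `Fin` than the members. By definition `⋂[ S ] F` is
-- `⋂ (_∈? S) F`, so the two lemmas below serve for both.
⋂ : {P : Pred (Fin m) 0ℓ} → Decidable P → (Fin m → Subset n) → Subset n
⋂ P? F = ⟪ (λ y → all? (λ x → P? x →-dec y ∈? F x)) ⟫

∈⋂⁺ : {P : Pred (Fin m) 0ℓ} (P? : Decidable P) {F : Fin m → Subset n} →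
  ∀ {y} → (∀ {x} → P x → y ∈ F x) → y ∈ ⋂ P? F
∈⋂⁺ P? {F} h = ∈⟪⟫⁺ (λ y → all? (λ x → P? x →-dec y ∈? F x)) (λ x → h {x})

∈⋂⁻ : {P : Pred (Fin m) 0ℓ} (P? : Decidable P) {F : Fin m → Subset n} →
  ∀ {x y} → y ∈ ⋂ P? F → P x → y ∈ F x
∈⋂⁻ P? {F} {x} y∈ = ∈⟪⟫⁻ (λ y → all? (λ x → P? x →-dec y ∈? F x)) y∈ x

⊆∧≢⇒⊂ : ∀ {A B : Subset n} → A ⊆ B → A ≢ B → A ⊂ B
⊆∧≢⇒⊂ {A = A} {B} A⊆B A≢B
  with x , x∉ ← ¬∀⟶∃¬ _ (λ x → x ∈ B → x ∈ A) (λ x → x ∈? B →-dec x ∈? A)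
                  (λ B⊆A → A≢B (⊆-antisym A⊆B (B⊆A _)))
  with x ∈? B
... | yes x∈B = A⊆B , x , x∈B , λ x∈A → x∉ (λ _ → x∈A)
... | no  x∉B = contradiction (λ x∈B → contradiction x∈B x∉B) x∉

nonempty : ∀ {p : Subset n} → 1 ≤ ∣ p ∣ → Nonempty p
nonempty {n = n} {p} 1≤ with nonempty? p
... | yes ne = ne
... | no ¬ne with () ← subst (1 ≤_) (trans (cong ∣_∣ (Empty-unique ¬ne)) (∣⊥∣≡0 n)) 1≤

two⁺ : ∀ {p : Subset n} {x y} → x ≢ y → x ∈ p → y ∈ p → 2 ≤ ∣ p ∣
two⁺ {p = p} {x} {y} x≢y x∈p y∈p =
  ≤-trans (s≤s (≤-trans (s≤s z≤n) (x∈p⇒∣p-x∣<∣p∣ (x∈p∧x≢y⇒x∈p-y x∈p x≢y))))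
          (x∈p⇒∣p-x∣<∣p∣ y∈p)

two⁻ : ∀ {p : Subset n} → 2 ≤ ∣ p ∣ → ∃[ x ] ∃[ y ] x ≢ y × x ∈ p × y ∈ p
two⁻ {p = outside ∷ p} 2≤ with x , y , x≢y , x∈p , y∈p ← two⁻ 2≤ =
  suc x , suc y , (λ { refl → x≢y refl }) , there x∈p , there y∈p
two⁻ {p = inside ∷ p} 2≤ with y , y∈p ← nonempty (s≤s⁻¹ 2≤) =
  zero , suc y , (λ ()) , here , there y∈p

lookup-injective : ∀ {A : Set} {xs : List A} → Unique xs →
  ∀ i j → lookup xs i ≡ lookup xs j → i ≡ j
lookup-injective (_  ∷ _) zero    zero    _  = refl
lookup-injective (x∉ ∷ _) zero    (suc j) eq = contradiction eq (All.lookup x∉ (∈-lookup j))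
lookup-injective (x∉ ∷ _) (suc i) zero    eq = contradiction (sym eq) (All.lookup x∉ (∈-lookup i))
lookup-injective (_  ∷ u) (suc i) (suc j) eq = cong suc (lookup-injective u i j eq)

maximal-⊆ : {P : Pred (Subset n) 0ℓ} → ∀ {X Y} → Maximal P X → P Y → X ⊆ Y → X ≡ Y
maximal-⊆ {X = X} {Y} (_ , ¬bigger) PY X⊆Y with X ≟ˢ Y
... | yes X≡Y = X≡Y
... | no  X≢Y = contradiction (Y , PY , ⊆∧≢⇒⊂ X⊆Y X≢Y) ¬bigger

∈-maximals⁻ : {P : Pred (Subset n) 0ℓ} (P? : Decidable P) → ∀ {X} → X List.∈ maximals P? → Maximal P X
∈-maximals⁻ P? X∈ = proj₂ (∈-filter⁻ (maximal? P?) {xs = allSubsets _} X∈)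

lookup-maximals : {P : Pred (Subset n) 0ℓ} (P? : Decidable P) → ∀ i → Maximal P (lookup (maximals P?) i)
lookup-maximals P? i = ∈-maximals⁻ P? (∈-lookup i)

maximals-inhabited : {P : Pred (Subset n) 0ℓ} (P? : Decidable P) → maximals P? ≢ [] → ∃ P
maximals-inhabited P? ne with maximals P? | ∈-maximals⁻ P?
... | []    | _ = contradiction refl ne
... | X ∷ _ | h = X , proj₁ (h (Any.here refl))

-- Labels and their adjacency.

-- The sets K b play the role of the maximal cliques. The list that accompanies
-- the largest set of a chain contains the other sets in decreasing order.
data Label (n m : ℕ) : Set where
  point : Fin n → Label n m
  block : Fin m → Label n m
  chain : Subset n → List (Subset n) → Label n m

height : Label n m → ℕ
height (point _)   = 0
height (block _)   = 1
height (chain _ c) = 2 + length c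

bottom : Subset n → List (Subset n) → Subset n
bottom A []      = A
bottom A (B ∷ c) = bottom B c

module Labels {n m} (K : Fin m → Subset n) where

  infix 4 _◁_ _◁?_

  -- Adjacency directed from the lower level to the higher one. `between` gives the chains one level
  -- down; `deeper` drops the largest set, on which the chains further down do not depend.
  data _◁_ : Label n m → Label n m → Set where
    in-block  : ∀ {v b} → v ∈ K b → point v ◁ block b
    in-bottom : ∀ {v A c} → v ∈ bottom A c → point v ◁ chain A c
    above-top : ∀ {b A c} → A ⊆ K b → block b ◁ chain A c
    between   : ∀ {A B C c} → B ⊆ A → A ⊆ C → chain A c ◁ chain C (B ∷ c)
    deeper    : ∀ {A B C c d} → chain A c ◁ chain B d → chain A c ◁ chain C (B ∷ d)

  chain◁chain? : ∀ A c C d → Dec (chain A c ◁ chain C d)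
  chain◁chain? A c C []      = no λ ()
  chain◁chain? A c C (B ∷ d) =
    map′ to from ((≡ˡ-dec _≟ˢ_ c d ×-dec B ⊆? A ×-dec A ⊆? C) ⊎-dec chain◁chain? A c B d)
    where
    to : (c ≡ d × B ⊆ A × A ⊆ C) ⊎ chain A c ◁ chain B d → chain A c ◁ chain C (B ∷ d)
    to (inj₁ (refl , B⊆A , A⊆C)) = between B⊆A A⊆C
    to (inj₂ l◁)                 = deeper l◁
    from : chain A c ◁ chain C (B ∷ d) → (c ≡ d × B ⊆ A × A ⊆ C) ⊎ chain A c ◁ chain B d
    from (between B⊆A A⊆C) = inj₁ (refl , B⊆A , A⊆C)
    from (deeper l◁)       = inj₂ l◁

  _◁?_ : Decidable₂ _◁_
  point v   ◁? point _   = no λ ()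
  point v   ◁? block b   = map′ in-block (λ { (in-block v∈) → v∈ }) (v ∈? K b)
  point v   ◁? chain A c = map′ in-bottom (λ { (in-bottom v∈) → v∈ }) (v ∈? bottom A c)
  block b   ◁? point _   = no λ ()
  block b   ◁? block _   = no λ ()
  block b   ◁? chain A c = map′ above-top (λ { (above-top A⊆) → A⊆ }) (A ⊆? K b)
  chain A c ◁? point _   = no λ ()
  chain A c ◁? block _   = no λ ()
  chain A c ◁? chain C d = chain◁chain? A c C d

  ◁⇒< : ∀ {l l′} → l ◁ l′ → height l < height l′
  ◁⇒< (in-block _)  = s≤s z≤n
  ◁⇒< (in-bottom _) = s≤s z≤n
  ◁⇒< (above-top _) = s≤s (s≤s z≤n)
  ◁⇒< (between _ _) = ≤-refl
  ◁⇒< (deeper l◁)   = m≤n⇒m≤1+n (◁⇒< l◁)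

  -- Heights separate the two constructors: `deeper` needs a drop of at least two levels.
  between⁻ : ∀ {A B C c d} → length c ≡ length d →
    chain A c ◁ chain C (B ∷ d) → c ≡ d × B ⊆ A × A ⊆ C
  between⁻ eq (between B⊆A A⊆C) = refl , B⊆A , A⊆C
  between⁻ eq (deeper l◁)       = contradiction (cong (2 +_) eq) (<⇒≢ (◁⇒< l◁))

  deeper⁻ : ∀ {A B C c d} → length c < length d →
    chain A c ◁ chain C (B ∷ d) → chain A c ◁ chain B d
  deeper⁻ lt (between _ _) = contradiction lt (<-irrefl refl)
  deeper⁻ lt (deeper l◁)   = l◁

  -- Closed sets and valid chains.

  -- `A` is the intersection of all blocks containing it; only the inclusion that can fail is
  -- stated.
  Closed : Pred (Subset n) 0ℓ
  Closed A = ∀ {v} → (∀ b → A ⊆ K b → v ∈ K b) → v ∈ A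

  -- Membership in 𝓕: closedness and two blocks around `A` make it an intersection of at least two
  -- blocks.
  record Flat (A : Subset n) : Set where
    constructor flat
    field
      size   : 2 ≤ ∣ A ∣
      closed : Closed A
      blocks : ∃[ b ] ∃[ b′ ] b ≢ b′ × A ⊆ K b × A ⊆ K b′

  data Valid : Label n m → Set where
    point : ∀ {v} → Valid (point v)
    block : ∀ {b} → Valid (block b)
    [_]   : ∀ {A} → Flat A → Valid (chain A [])
    _∷_   : ∀ {A B c} → Flat A × B ⊂ A → Valid (chain B c) → Valid (chain A (B ∷ c))

  top-flat : ∀ {A c} → Valid (chain A c) → Flat A
  top-flat [ fl ]         = fl
  top-flat ((fl , _) ∷ _) = fl

  -- Together with `chain B c` this provides both ends of the interval `B ⊆ D ⊆ A` of neighbours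
  -- `chain D c` one level down.
  skip : ∀ {A B c} → Valid (chain A (B ∷ c)) → Valid (chain A c)
  skip ((fl , _)   ∷ [ _ ])           = [ fl ]
  skip ((fl , B⊂A) ∷ ((_ , C⊂B) ∷ c)) = (fl , ⊂-trans C⊂B B⊂A) ∷ c

  -- The source of termination: sizes strictly increase along a chain.
  length<size : ∀ {A c} → Valid (chain A c) → length c < ∣ A ∣
  length<size [ flat size _ _ ]  = <⇒≤ size
  length<size ((_ , B⊂A) ∷ val) = ≤-trans (s≤s (length<size val)) (p⊂q⇒∣p∣<∣q∣ B⊂A)

  module Envelope {p} (S : Subset p) (D : Fin p → Subset n) where

    Covers : Pred (Fin m) 0ℓ
    Covers b = ∀ x → x ∈ S → D x ⊆ K b

    covers? : Decidable Covers
    covers? b = all? (λ x → x ∈? S →-dec D x ⊆? K b)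

    -- For closed `D x` these are the meet and the join among closed sets; `sup` is the closure of
    -- the union of the `D x`.
    inf sup : Subset n
    inf = ⋂ (_∈? S) D
    sup = ⋂ covers? K

    inf⊆ : ∀ {x} → x ∈ S → inf ⊆ D x
    inf⊆ x∈S v∈ = ∈⋂⁻ (_∈? S) v∈ x∈S

    ⊆inf : ∀ {A} → (∀ {x} → x ∈ S → A ⊆ D x) → A ⊆ inf
    ⊆inf h v∈A = ∈⋂⁺ (_∈? S) (λ x∈S → h x∈S v∈A)

    ⊆sup : ∀ {x} → x ∈ S → D x ⊆ sup
    ⊆sup x∈S v∈ = ∈⋂⁺ covers? (λ cov → cov _ x∈S v∈)

    sup⊆ : ∀ {b} → (∀ {x} → x ∈ S → D x ⊆ K b) → sup ⊆ K b
    sup⊆ h v∈ = ∈⋂⁻ covers? v∈ (λ x x∈S → h x∈S)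

    inf-closed : (∀ {x} → x ∈ S → Closed (D x)) → Closed inf
    inf-closed closed h =
      ∈⋂⁺ (_∈? S) (λ x∈S → closed x∈S (λ b D⊆ → h b (⊆-trans (inf⊆ x∈S) D⊆)))

    sup-closed : Closed sup
    sup-closed h = ∈⋂⁺ covers? (λ {b} cov → h b (sup⊆ (λ {x} → cov x)))

  -- Models: labellings of partite graphs.

  -- The invariant of the induction along the series: `label` is a bijection onto the valid labels
  -- of height below `k`, under which levels become heights and edges become `◁` in one direction or
  -- the other.
  record Model (H : Partite k) : Set where
    field
      label     : Fin (order H) → Label n m
      injective : ∀ {x y} → label x ≡ label y → x ≡ y
      valid     : ∀ x → Valid (label x)
      vertex    : ∀ {l} → Valid l → height l < k → ∃[ x ] label x ≡ l
      level≡    : ∀ x → toℕ (level H x) ≡ height (label x)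
      adj⁺      : ∀ {x y} → label x ◁ label y → _~_ H x y
      adj⁻      : ∀ {x y} → _~_ H x y → label x ◁ label y ⊎ label y ◁ label x

    adj-sym⁺ : ∀ {x y} → label y ◁ label x → _~_ H x y
    adj-sym⁺ y◁x = ~-sym H (adj⁺ y◁x)

    height< : ∀ x → height (label x) < k
    height< x = subst (_< k) (level≡ x) (toℕ<n (level H x))

    ∈V⁺ : ∀ {x} → height (label x) ≡ i → x ∈ V H i
    ∈V⁺ {x = x} eq = ∈⟪⟫⁺ (λ x → toℕ (level H x) ℕ.≟ _) (trans (level≡ x) eq)

    ∈V⁻ : ∀ {x} → x ∈ V H i → height (label x) ≡ i
    ∈V⁻ {x = x} x∈ = trans (sym (level≡ x)) (∈⟪⟫⁻ (λ x → toℕ (level H x) ℕ.≟ _) x∈)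

    ∈N⁺ : ∀ {x y} → label y ◁ label x → y ∈ N H x
    ∈N⁺ {x} y◁x = ∈⟪⟫⁺ (_~?_ H x) (adj-sym⁺ y◁x)

    ∈N⁻ : ∀ {x y} → y ∈ N H x → height (label y) ≤ height (label x) → label y ◁ label x
    ∈N⁻ {x} y∈ le with adj⁻ (∈⟪⟫⁻ (_~?_ H x) y∈)
    ... | inj₁ x◁y = contradiction (◁⇒< x◁y) (≤⇒≯ le)
    ... | inj₂ y◁x = y◁x

    -- The vertices joined to a new vertex labelled l.
    below : Label n m → Subset (order H)
    below l = ⟪ (λ y → label y ◁? l) ⟫

    ∈below⁺ : ∀ {l y} → label y ◁ l → y ∈ below l
    ∈below⁺ {l} = ∈⟪⟫⁺ (λ y → label y ◁? l)

    ∈below⁻ : ∀ {l y} → y ∈ below l → label y ◁ l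
    ∈below⁻ {l} = ∈⟪⟫⁻ (λ y → label y ◁? l)

  open Model

  -- Serves both for the blocks over the vertex level and for the chains over each later graph.
  -- `new-injective` and `new-vertex` keep the labelling bijective, `new-below` makes the edges
  -- agree.
  module _ (H : Partite k) (M : Model H) (Xs : List (Subset (order H)))
    (new : Fin (length Xs) → Label n m)
    (new-injective : ∀ {i j} → new i ≡ new j → i ≡ j)
    (new-valid : ∀ i → Valid (new i))
    (new-height : ∀ i → height (new i) ≡ k)
    (new-vertex : ∀ {l} → Valid l → height l ≡ k → ∃[ i ] new i ≡ l)
    (new-below : ∀ i → lookup Xs i ≡ below M (new i))
    where

    open AddLevel H Xs using (Vertex; split; levelᵥ; Adj)

    private
      labelᵥ : Vertex → Label n m
      labelᵥ (inj₁ x) = label M x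
      labelᵥ (inj₂ i) = new i

      old≢new : ∀ {x i} → label M x ≢ new i
      old≢new {x} {i} eq = <⇒≢ (height< M x) (trans (cong height eq) (new-height i))

      injectiveᵥ : ∀ {u v} → labelᵥ u ≡ labelᵥ v → u ≡ v
      injectiveᵥ {inj₁ x} {inj₁ y} eq = cong inj₁ (injective M eq)
      injectiveᵥ {inj₁ x} {inj₂ i} eq = contradiction eq old≢new
      injectiveᵥ {inj₂ i} {inj₁ x} eq = contradiction (sym eq) old≢new
      injectiveᵥ {inj₂ i} {inj₂ j} eq = cong inj₂ (new-injective eq)

      validᵥ : ∀ u → Valid (labelᵥ u)
      validᵥ (inj₁ x) = valid M x
      validᵥ (inj₂ i) = new-valid i

      vertexᵥ : ∀ {l} → Valid l → height l < suc k → ∃[ u ] labelᵥ u ≡ l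
      vertexᵥ {l} val lt with height l ℕ.≟ k
      ... | yes eq with i , refl ← new-vertex val eq = inj₂ i , refl
      ... | no ≢k  with x , refl ← vertex M val (≤∧≢⇒< (s≤s⁻¹ lt) ≢k) = inj₁ x , refl

      levelᵥ≡ : ∀ u → toℕ (levelᵥ u) ≡ height (labelᵥ u)
      levelᵥ≡ (inj₁ x) = trans (toℕ-inject₁ (level H x)) (level≡ M x)
      levelᵥ≡ (inj₂ i) = trans (toℕ-fromℕ k) (sym (new-height i))

      adjᵥ⁺ : ∀ u v → labelᵥ u ◁ labelᵥ v → Adj u v
      adjᵥ⁺ (inj₁ x) (inj₁ y) x◁y = adj⁺ M x◁y
      adjᵥ⁺ (inj₁ x) (inj₂ i) x◁i = subst (x ∈_) (sym (new-below i)) (∈below⁺ M x◁i)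
      adjᵥ⁺ (inj₂ i) (inj₁ x) i◁x =
        contradiction (subst (_< _) (new-height i) (◁⇒< i◁x)) (<-asym (height< M x))
      adjᵥ⁺ (inj₂ i) (inj₂ j) i◁j =
        contradiction (◁⇒< i◁j) (<-irrefl (trans (new-height i) (sym (new-height j))))

      adjᵥ⁻ : ∀ u v → Adj u v → labelᵥ u ◁ labelᵥ v ⊎ labelᵥ v ◁ labelᵥ u
      adjᵥ⁻ (inj₁ x) (inj₁ y) x~y = adj⁻ M x~y
      adjᵥ⁻ (inj₁ x) (inj₂ i) x∈  = inj₁ (∈below⁻ M (subst (x ∈_) (new-below i) x∈))
      adjᵥ⁻ (inj₂ i) (inj₁ x) x∈  = inj₂ (∈below⁻ M (subst (x ∈_) (new-below i) x∈))

      split-injective : ∀ {u v} → split u ≡ split v → u ≡ v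
      split-injective {u} {v} eq =
        trans (sym (join-splitAt (order H) _ u))
              (trans (cong (join (order H) _) eq) (join-splitAt (order H) _ v))

    addLevel-model : Model (addLevel H Xs)
    addLevel-model = record
      { label     = labelᵥ ∘ split
      ; injective = split-injective ∘ injectiveᵥ
      ; valid     = validᵥ ∘ split
      ; vertex    = λ val lt → let u , eq = vertexᵥ val lt in
          join (order H) _ u , trans (cong labelᵥ (splitAt-join (order H) _ u)) eq
      ; level≡    = levelᵥ≡ ∘ split
      ; adj⁺      = λ {u} {v} → adjᵥ⁺ (split u) (split v)
      ; adj⁻      = λ {u} {v} → adjᵥ⁻ (split u) (split v)
      }

  -- Common neighbourhoods in terms of labels.

  module _ {j} {H : Partite (2 + j)} (M : Model H) where

    Top : Pred (Subset (order H)) 0ℓ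
    Top T = ∀ {x} → x ∈ T → height (label M x) ≡ 1 + j

    -- Label versions of the conditions in `Clean`. At heights up to `j` every valid label belongs
    -- to a vertex, so for inhabited `T` on the last level they agree with the conditions in the
    -- graph.
    Common : Subset (order H) → Pred (Label n m) 0ℓ
    Common T l = ∀ {x} → x ∈ T → l ◁ label M x

    CommonAt : ℕ → Subset (order H) → Pred (Label n m) 0ℓ
    CommonAt i T l = Valid l × height l ≡ i × Common T l

    Two : ℕ → Pred (Subset (order H)) 0ℓ
    Two i T = ∃[ l ] ∃[ l′ ] l ≢ l′ × CommonAt i T l × CommonAt i T l′

    Same : ℕ → Pred (Subset (order H)) 0ℓ
    Same i T = ∀ {x y l} → x ∈ T → y ∈ T → Valid l → height l ≡ i →
      l ◁ label M x → l ◁ label M y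

    ⋂N⁻ : ∀ {T y} → Top T → y ∈ ⋂[ T ] (N H) → Common T (label M y)
    ⋂N⁻ {T} {y} top y∈ x∈T = ∈N⁻ M (∈⋂⁻ (_∈? T) y∈ x∈T)
      (subst (height (label M y) ≤_) (sym (top x∈T)) (s≤s⁻¹ (height< M y)))

    commonAt⇒vertex : ∀ {T l} → i ≤ j → CommonAt i T l →
      ∃[ y ] label M y ≡ l × y ∈ ⋂[ T ] (N H) × y ∈ ⋂[ T ] (N[_] H i)
    commonAt⇒vertex {T = T} i≤j (val , refl , com)
      with y , refl ← vertex M val (s≤s (m≤n⇒m≤1+n i≤j)) =
      y , refl , ∈⋂⁺ (_∈? T) (λ x∈T → ∈N⁺ M (com x∈T)) ,
      ∈⋂⁺ (_∈? T) (λ x∈T → x∈p∩q⁺ (∈N⁺ M (com x∈T) , ∈V⁺ M refl))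

    two⇒∣⋂N∣ : ∀ {T} → i ≤ j → Two i T → 2 ≤ ∣ ⋂[ T ] (N H) ∣
    two⇒∣⋂N∣ i≤j (l , l′ , l≢l′ , p , p′)
      with y , refl , y∈ , _ ← commonAt⇒vertex i≤j p | y′ , refl , y′∈ , _ ← commonAt⇒vertex i≤j p′
      = two⁺ (l≢l′ ∘ cong (label M)) y∈ y′∈

    two⁺-common : ∀ {T} → i ≤ j → Two i T → TwoCommon H i T
    two⁺-common i≤j (l , l′ , l≢l′ , p , p′)
      with y , refl , _ , y∈ ← commonAt⇒vertex i≤j p | y′ , refl , _ , y′∈ ← commonAt⇒vertex i≤j p′
      = two⁺ (l≢l′ ∘ cong (label M)) y∈ y′∈

    -- The member of `T` fixes the level of the common neighbours: over an empty `T` the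
    -- intersection would contain every vertex.
    two⁻-common : ∀ {T x} → Top T → x ∈ T → TwoCommon H i T → Two i T
    two⁻-common {i} {T} top x₀∈T 2≤ with y , y′ , y≢y′ , y∈ , y′∈ ← two⁻ 2≤ =
      label M y , label M y′ , y≢y′ ∘ injective M , at y∈ , at y′∈
      where
      at : ∀ {y} → y ∈ ⋂[ T ] (N[_] H i) → CommonAt i T (label M y)
      at {y} y∈ = valid M y ,
        ∈V⁻ M (proj₂ (x∈p∩q⁻ _ _ (∈⋂⁻ (_∈? T) y∈ x₀∈T))) ,
        ⋂N⁻ top (∈⋂⁺ (_∈? T) (λ x∈T → proj₁ (x∈p∩q⁻ _ _ (∈⋂⁻ (_∈? T) y∈ x∈T))))

    same⁺ : ∀ {T} → i ≤ j → Top T → Same i T → SameN H i T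
    same⁺ {i} {T} i≤j top same x y x∈T y∈T = ⊆-antisym (incl x∈T y∈T) (incl y∈T x∈T)
      where
      incl : ∀ {x y} → x ∈ T → y ∈ T → N[_] H i x ⊆ N[_] H i y
      incl x∈T y∈T {z} z∈ with z∈N , z∈V ← x∈p∩q⁻ _ _ z∈ = x∈p∩q⁺
        ( ∈N⁺ M (same x∈T y∈T (valid M z) (∈V⁻ M z∈V)
            (∈N⁻ M z∈N (≤-trans (≤-reflexive (∈V⁻ M z∈V))
                         (≤-trans (m≤n⇒m≤1+n i≤j) (≤-reflexive (sym (top x∈T)))))))
        , z∈V )

    same⁻ : ∀ {T} → i ≤ j → Top T → SameN H i T → Same i T
    same⁻ {i} {T} i≤j top same {x} {y} x∈T y∈T val refl l◁x
      with z , refl ← vertex M val (s≤s (m≤n⇒m≤1+n i≤j)) =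
      ∈N⁻ M (proj₁ (x∈p∩q⁻ _ _ (subst (z ∈_) (same x y x∈T y∈T) (x∈p∩q⁺ (∈N⁺ M l◁x , ∈V⁺ M refl)))))
        (≤-trans (m≤n⇒m≤1+n i≤j) (≤-reflexive (sym (top y∈T))))

  -- Cleanness as a common tail.

  -- The number of the level just below that of the chains of length 1 + j,
  -- not counting the blocks.
  rung : ℕ → ℕ
  rung zero    = 0
  rung (suc j) = 2 + j

  tall⇒chain : ∀ (l : Label n m) → height l ≡ 2 + j → ∃[ D ] ∃[ d ] length d ≡ j × l ≡ chain D d
  tall⇒chain (chain D d) refl = D , d , refl , refl

  Tails : ∀ {H : Partite (3 + j)} → Model H → List (Subset n) → Pred (Subset (order H)) 0ℓ
  Tails M d T = ∀ {x} → x ∈ T → ∃[ D ] label M x ≡ chain D d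

  -- The chains in `T` differ only in their largest sets, which do not affect the level where
  -- neighbourhoods must coincide: the points for 4-partite graphs, the chains two levels down from
  -- 5-partite graphs on.
  clean⁺ : ∀ {H : Partite (3 + j)} (M : Model H) {T d} → length d ≡ j → Top M T → Tails M d T →
    Two M 1 T → Two M (rung (length d)) T → Clean H T
  clean⁺ M {d = []} refl top tails two₁ two =
    two⁺-common M ≤-refl two₁ , two⁺-common M z≤n two
  clean⁺ {H = H} M {T} {R ∷ []} refl top tails two₁ two =
    two⁺-common M ≤-refl two , two⁺-common M (s≤s z≤n) two₁ , same⁺ M z≤n top same
    where
    same : Same M 0 T
    same x∈T y∈T val eq l◁x with tails x∈T | tails y∈T
    ... | D , p | D′ , q rewrite p | q with l◁x
    ... | in-bottom v∈ = in-bottom v∈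
  clean⁺ {H = H} M {T} {R ∷ R′ ∷ r} refl top tails two₁ two =
    two⁺-common M ≤-refl two , same⁺ M (n≤1+n _) top same , two⁺-common M (s≤s z≤n) two₁
    where
    same : Same M (2 + length r) T
    same {l = l} x∈T y∈T val eq l◁x with tails x∈T | tails y∈T | tall⇒chain l eq
    ... | D , p | D′ , q | A , a , eq′ , refl rewrite p | q =
      deeper (deeper⁻ (s≤s (≤-reflexive eq′)) l◁x)

  -- The neighbours two levels down form the interval from `R′` to `R` over `r`. Probing with its
  -- ends `chain R r` and `chain R′ r` yields the two inclusions.
  tail-determined : ∀ {D D₂ R R′ R₂ R₂′ r r₂} → Valid (chain D (R ∷ R′ ∷ r)) → length r ≡ length r₂ →
    (∀ {l} → Valid l → height l ≡ 2 + length r →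
       l ◁ chain D (R ∷ R′ ∷ r) → l ◁ chain D₂ (R₂ ∷ R₂′ ∷ r₂)) →
    r ≡ r₂ × R ⊆ R₂ × R₂′ ⊆ R′
  tail-determined (_ ∷ val@((_ , R′⊂R) ∷ val′)) eq h
    with refl , _ , R⊆R₂ ← between⁻ eq (deeper⁻ (s≤s (≤-reflexive eq))
                             (h (skip val) refl (deeper (between (proj₁ R′⊂R) ⊆-refl))))
    with _ , R₂′⊆R′ , _ ← between⁻ refl (deeper⁻ ≤-refl
                             (h val′ refl (deeper (between ⊆-refl (proj₁ R′⊂R)))))
    = refl , R⊆R₂ , R₂′⊆R′

  -- Equal neighbourhoods recover the tail. For 3-partite graphs it is empty, for 4-partite graphs
  -- its only set consists of the neighbouring points, and beyond that `tail-determined` is used in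
  -- both directions.
  clean⁻ : ∀ {H : Partite (3 + j)} (M : Model H) {T x} → Top M T → x ∈ T → Clean H T →
    ∃[ d ] length d ≡ j × Tails M d T × Two M 1 T × Two M (rung (length d)) T
  clean⁻ {0} {H} M {T} top x∈T (common₁ , common₀) =
    [] , refl , tails , two⁻-common M top x∈T common₁ , two⁻-common M top x∈T common₀
    where
    tails : Tails M [] T
    tails {x} x∈T with tall⇒chain (label M x) (top x∈T)
    ... | D , [] , refl , eq = D , eq
  clean⁻ {1} {H} M {T} {x} top x∈T (common₂ , common₁ , sameN)
    with tall⇒chain (label M x) (top x∈T)
  ... | D , R ∷ [] , refl , x≡ =
    R ∷ [] , refl , tails , two⁻-common M top x∈T common₁ , two⁻-common M top x∈T common₂
    where
    transfer : ∀ {y z l l₁ l₂} → y ∈ T → z ∈ T → label M y ≡ l₁ → label M z ≡ l₂ →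
      Valid l → height l ≡ 0 → l ◁ l₁ → l ◁ l₂
    transfer y∈T z∈T refl refl = same⁻ M z≤n top sameN y∈T z∈T
    incl : ∀ {y z D D′ R R′} → y ∈ T → z ∈ T →
      label M y ≡ chain D (R ∷ []) → label M z ≡ chain D′ (R′ ∷ []) → R ⊆ R′
    incl y∈T z∈T p q v∈R
      with in-bottom v∈R′ ← transfer y∈T z∈T p q point refl (in-bottom v∈R)
      = v∈R′
    tails : Tails M (R ∷ []) T
    tails {y} y∈T with tall⇒chain (label M y) (top y∈T)
    ... | D′ , R′ ∷ [] , refl , y≡ =
      D′ , trans y≡ (cong (λ R → chain D′ (R ∷ [])) (⊆-antisym (incl y∈T x∈T y≡ x≡) (incl x∈T y∈T x≡ y≡)))
  clean⁻ {suc (suc j)} {H} M {T} {x} top x∈T (commonⱼ , sameN , common₁)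
    with tall⇒chain (label M x) (top x∈T)
  ... | D , R ∷ R′ ∷ r , refl , x≡ =
    R ∷ R′ ∷ r , refl , tails , two⁻-common M top x∈T common₁ , two⁻-common M top x∈T commonⱼ
    where
    transfer : ∀ {y z l l₁ l₂} → y ∈ T → z ∈ T → label M y ≡ l₁ → label M z ≡ l₂ →
      Valid l → height l ≡ 2 + length r → l ◁ l₁ → l ◁ l₂
    transfer y∈T z∈T refl refl = same⁻ M (n≤1+n _) top sameN y∈T z∈T
    tails : Tails M (R ∷ R′ ∷ r) T
    tails {y} y∈T with tall⇒chain (label M y) (top y∈T)
    ... | D₂ , R₂ ∷ R₂′ ∷ r₂ , eq , y≡
      with refl , R⊆R₂ , R₂′⊆R′ ← tail-determined (subst Valid x≡ (valid M x))
             (sym (suc-injective (suc-injective eq))) (transfer x∈T y∈T x≡ y≡)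
      with _ , R₂⊆R , R′⊆R₂′ ← tail-determined (subst Valid y≡ (valid M y))
             refl (transfer y∈T x∈T y≡ x≡)
      with refl ← ⊆-antisym R⊆R₂ R₂⊆R | refl ← ⊆-antisym R₂′⊆R′ R′⊆R₂′
      = D₂ , y≡

  -- Chains are determined by their lower neighbours.

  -- One inclusion suffices, because enlarging the largest set can only lose blocks while the other
  -- neighbours force it to grow. Hence the sets `below` of chains of equal length form an
  -- antichain.
  chain-determined : ∀ {A A′ c c′} → Valid (chain A c) → Valid (chain A′ c′) → length c ≡ length c′ →
    (∀ {l} → Valid l → height l < 2 + length c → l ◁ chain A c → l ◁ chain A′ c′) →
    A ≡ A′ × c ≡ c′
  chain-determined {A} {A′} {c} {c′} val val′ eq h = go val val′ eq h
    where
    -- `A` is the intersection of the blocks around it, and each of these also contains `A′`.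
    A′⊆A : A′ ⊆ A
    A′⊆A v∈ = Flat.closed (top-flat val) λ b A⊆ → blocks b A⊆ v∈
      where
      blocks : ∀ b → A ⊆ K b → A′ ⊆ K b
      blocks b A⊆ with above-top A′⊆ ← h (block {b}) (s≤s (s≤s z≤n)) (above-top A⊆) = A′⊆

    go : ∀ {c c′} → Valid (chain A c) → Valid (chain A′ c′) → length c ≡ length c′ →
      (∀ {l} → Valid l → height l < 2 + length c → l ◁ chain A c → l ◁ chain A′ c′) →
      A ≡ A′ × c ≡ c′
    go {[]} {[]} _ _ _ h = ⊆-antisym A⊆A′ A′⊆A , refl
      where
      A⊆A′ : A ⊆ A′
      A⊆A′ v∈ with in-bottom v∈′ ← h point (s≤s z≤n) (in-bottom v∈) = v∈′
    go {B ∷ d} {B′ ∷ d′} val@((_ , B⊂A) ∷ val-d) _ eq h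
      -- Probing with the ends `chain B d` and `chain A d` of the interval under `A` leaves only
      -- `B ⊆ B′` open.
      with refl , B′⊆B , _ ← between⁻ (suc-injective eq) (h val-d ≤-refl (between ⊆-refl (proj₁ B⊂A)))
      with _ , _ , A⊆A′ ← between⁻ refl (h (skip val) ≤-refl (between (proj₁ B⊂A) ⊆-refl))
      = ⊆-antisym A⊆A′ A′⊆A , cong (_∷ d) (⊆-antisym (B⊆B′ val-d h) B′⊆B)
      where
      -- This inclusion is visible further down: in the points if `d` is empty, otherwise in the
      -- upper end of the interval under `B`.
      B⊆B′ : ∀ {d} → Valid (chain B d) →
        (∀ {l} → Valid l → height l < 3 + length d → l ◁ chain A (B ∷ d) → l ◁ chain A′ (B′ ∷ d)) →
        B ⊆ B′
      B⊆B′ [ _ ] h v∈ with in-bottom v∈′ ← h point (s≤s z≤n) (in-bottom v∈) = v∈′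
      B⊆B′ (fl ∷ val) h
        with _ , _ , B⊆ ← between⁻ refl (deeper⁻ ≤-refl (h (skip (fl ∷ val)) (s≤s (s≤s (s≤s (n≤1+n _))))
                            (deeper (between (proj₁ (proj₂ fl)) ⊆-refl))))
        = B⊆

  -- Neighbourhoods of chains as members of `V*`.

  module _ {j} {H : Partite (2 + j)} (M : Model H) where

    below⊆⇒≡ : ∀ {A A′ c c′} → Valid (chain A c) → Valid (chain A′ c′) → length c ≡ j → length c′ ≡ j →
      below M (chain A c) ⊆ below M (chain A′ c′) → A ≡ A′ × c ≡ c′
    below⊆⇒≡ {A} {A′} {c} {c′} val val′ eq eq′ incl =
      chain-determined val val′ (trans eq (sym eq′)) h
      where
      h : ∀ {l} → Valid l → height l < 2 + length c → l ◁ chain A c → l ◁ chain A′ c′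
      h {l} vl lt l◁ with y , refl ← vertex M vl (subst (λ j → height l < 2 + j) eq lt) =
        ∈below⁻ M (incl (∈below⁺ M l◁))

    tops : Label n m → Subset (order H)
    tops l = below M l ∩ V H (1 + j)

    -- The generating set is `tops l`. The two implications say that the remaining neighbours of `l`
    -- are exactly the common neighbours of `tops l`; `l₁` and `l₂` provide its two elements.
    below-∈V* : ∀ {l l₁ l₂} → l₁ ≢ l₂ →
      Valid l₁ × height l₁ ≡ 1 + j × l₁ ◁ l → Valid l₂ × height l₂ ≡ 1 + j × l₂ ◁ l →
      (∀ {a l′} → height a < 1 + j → a ◁ l → height l′ ≡ 1 + j → l′ ◁ l → a ◁ l′) →
      (∀ {a} → (∀ {l′} → Valid l′ → height l′ ≡ 1 + j → l′ ◁ l → a ◁ l′) → a ◁ l) →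
      i ≤ j → Two M i (tops l) → Clean H (tops l) → V* H (below M l)
    below-∈V* {l = l} {l₁} {l₂} l₁≢l₂ (v₁ , eq₁ , l₁◁) (v₂ , eq₂ , l₂◁) shrink grow i≤j two clean =
      ( tops l , (λ x x∈ → proj₂ (x∈p∩q⁻ _ _ x∈)) , 2≤tops , two⇒∣⋂N∣ M i≤j two
      , ⊆-antisym below⊆ ⊆below ) , clean
      where
      T = tops l

      vertex-∈ : ∀ {l′} → Valid l′ → height l′ ≡ 1 + j → l′ ◁ l → ∃[ x ] label M x ≡ l′ × x ∈ T
      vertex-∈ val eq l′◁ with x , refl ← vertex M val (s≤s (≤-reflexive eq)) =
        x , refl , x∈p∩q⁺ (∈below⁺ M l′◁ , ∈V⁺ M eq)

      2≤tops : 2 ≤ ∣ T ∣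
      2≤tops with x , refl , x∈ ← vertex-∈ v₁ eq₁ l₁◁ | y , refl , y∈ ← vertex-∈ v₂ eq₂ l₂◁ =
        two⁺ (l₁≢l₂ ∘ cong (label M)) x∈ y∈

      T-top : Top M T
      T-top x∈ = ∈V⁻ M (proj₂ (x∈p∩q⁻ _ _ x∈))

      below⊆ : below M l ⊆ T ∪ ⋂[ T ] (N H)
      below⊆ {y} y∈ with height (label M y) ℕ.≟ 1 + j
      ... | yes eq = x∈p∪q⁺ (inj₁ (x∈p∩q⁺ (y∈ , ∈V⁺ M eq)))
      ... | no ≢1+j = x∈p∪q⁺ (inj₂ (∈⋂⁺ (_∈? T) λ x∈T → ∈N⁺ M
              (shrink (≤∧≢⇒< (s≤s⁻¹ (height< M y)) ≢1+j) (∈below⁻ M y∈) (T-top x∈T)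
                      (∈below⁻ M (proj₁ (x∈p∩q⁻ _ _ x∈T))))))

      ⊆below : T ∪ ⋂[ T ] (N H) ⊆ below M l
      ⊆below {y} y∈ with x∈p∪q⁻ _ _ y∈
      ... | inj₁ y∈T = proj₁ (x∈p∩q⁻ _ _ y∈T)
      ... | inj₂ y∈N = ∈below⁺ M (grow common)
        where
        common : ∀ {l′} → Valid l′ → height l′ ≡ 1 + j → l′ ◁ l → label M y ◁ l′
        common val eq l′◁ with x , refl , x∈T ← vertex-∈ val eq l′◁ = ⋂N⁻ M T-top y∈N x∈T

    -- Covering a generating set and its common neighbours by one chain is enough; maximality later
    -- turns the inclusion into an equality.
    V*-⊆below : ∀ {X} → V* H X →
      (∀ {S x y} → Top M S → x ≢ y → x ∈ S → y ∈ S → 2 ≤ ∣ ⋂[ S ] (N H) ∣ → Clean H S →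
        ∃[ A ] ∃[ c ] Valid (chain A c) × length c ≡ j
          × (∀ {x} → x ∈ S → label M x ◁ chain A c)
          × (∀ {a} → Valid a → Common M S a → a ◁ chain A c)) →
      ∃[ A ] ∃[ c ] Valid (chain A c) × length c ≡ j × X ⊆ below M (chain A c)
    V*-⊆below ((S , S⊆V , 2≤S , 2≤N , refl) , clean) cover =
      let x , y , x≢y , x∈S , y∈S = two⁻ 2≤S
          A , c , val , len , S◁ , N◁ = cover S-top x≢y x∈S y∈S 2≤N (subst (Clean H) (X∩V≡S x∈S) clean)
          X⊆ : S ∪ ⋂[ S ] (N H) ⊆ below M (chain A c)
          X⊆ = λ {z} z∈ → case x∈p∪q⁻ _ _ z∈ of λ
            { (inj₁ z∈S) → ∈below⁺ M (S◁ z∈S)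
            ; (inj₂ z∈N) → ∈below⁺ M (N◁ (valid M z) (⋂N⁻ M S-top z∈N)) }
      in A , c , val , len , X⊆
      where
      S-top : Top M S
      S-top {z} z∈S = ∈V⁻ M (S⊆V z z∈S)

      -- Common neighbours of an inhabited `S` lie on lower levels, so cleanness of `X ∩ V_{k-1}` is
      -- cleanness of `S`.
      X∩V≡S : ∀ {x} → x ∈ S → (S ∪ ⋂[ S ] (N H)) ∩ V H (1 + j) ≡ S
      X∩V≡S x∈S = ⊆-antisym to λ z∈S → x∈p∩q⁺ (x∈p∪q⁺ (inj₁ z∈S) , S⊆V _ z∈S)
        where
        to : (S ∪ ⋂[ S ] (N H)) ∩ V H (1 + j) ⊆ S
        to z∈ with z∈X , z∈V ← x∈p∩q⁻ _ _ z∈ with x∈p∪q⁻ _ _ z∈X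
        ... | inj₁ z∈S = z∈S
        ... | inj₂ z∈N = contradiction (◁⇒< (⋂N⁻ M S-top z∈N x∈S))
                           (<-irrefl (trans (∈V⁻ M z∈V) (sym (S-top x∈S))))

  -- Lowering the top from `A` to `D` keeps the blocks, and raising the set under it from `B` to `D`
  -- keeps the points and relaxes the upper bound on chains. The height bound rules out the interval
  -- itself.
  shrink-top : ∀ {a A B D d} → B ⊆ D → D ⊆ A → height a < 2 + length d →
    a ◁ chain A (B ∷ d) → a ◁ chain D d
  shrink-top {d = []}    B⊆D D⊆A lt (in-bottom v∈)         = in-bottom (B⊆D v∈)
  shrink-top {d = _ ∷ _} B⊆D D⊆A lt (in-bottom v∈)         = in-bottom v∈
  shrink-top             B⊆D D⊆A lt (above-top A⊆)         = above-top (⊆-trans D⊆A A⊆)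
  shrink-top             B⊆D D⊆A lt (between _ _)          = contradiction lt (<-irrefl refl)
  shrink-top             B⊆D D⊆A lt (deeper (between p q)) = between p (⊆-trans q B⊆D)
  shrink-top             B⊆D D⊆A lt (deeper (deeper a◁))   = deeper a◁

  -- The two ends of the interval suffice: points and chains are read off at `B`, blocks at `A`.
  grow-top : ∀ {a A B d} → a ◁ chain B d → a ◁ chain A d → a ◁ chain A (B ∷ d)
  grow-top {point _}   (in-bottom v∈) _              = in-bottom v∈
  grow-top {block _}   _              (above-top A⊆) = above-top A⊆
  grow-top {chain _ _} a◁             _              = deeper a◁

  below-∈V*-[] : ∀ {H : Partite 2} (M : Model H) {A} → Flat A → V* H (below M (chain A []))
  below-∈V*-[] M {A} (flat size closed (b , b′ , b≢b′ , A⊆ , A⊆′)) =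
    below-∈V* M (λ { refl → b≢b′ refl }) (block , refl , above-top A⊆) (block , refl , above-top A⊆′)
      shrink grow z≤n two _
    where
    shrink : ∀ {a l′} → height a < 1 → a ◁ chain A [] → height l′ ≡ 1 → l′ ◁ chain A [] → a ◁ l′
    shrink {l′ = block _} _        (in-bottom v∈) _ (above-top A⊆) = in-block (A⊆ v∈)
    shrink                (s≤s ()) (above-top _)  _ _

    grow : ∀ {a} → (∀ {l′} → Valid l′ → height l′ ≡ 1 → l′ ◁ chain A [] → a ◁ l′) → a ◁ chain A []
    -- One block around `A` already shows that `a` is a point; closedness then puts it into `A`.
    grow h with in-block _ ← h (block {b}) refl (above-top A⊆) =
      in-bottom (closed λ b A⊆ → case h (block {b}) refl (above-top A⊆) of λ { (in-block v∈) → v∈ })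

    common : ∀ {v} → v ∈ A → CommonAt M 0 (tops M (chain A [])) (point v)
    common {v} v∈A = point , refl , λ x∈ → let x∈A , x∈V = x∈p∩q⁻ _ _ x∈ in
      shrink (s≤s z≤n) (in-bottom v∈A) (∈V⁻ M x∈V) (∈below⁻ M x∈A)

    two : Two M 0 (tops M (chain A []))
    two with v , v′ , v≢v′ , v∈ , v′∈ ← two⁻ size =
      point v , point v′ , (λ { refl → v≢v′ refl }) , common v∈ , common v′∈

  -- The neighbours on the last level are the chains `D` over `d` with `B ⊆ D ⊆ A`, and the ends are
  -- distinct because `B ⊂ A`.
  below-∈V*-∷ : ∀ {H : Partite (3 + j)} (M : Model H) {A B d} → length d ≡ j →
    Valid (chain A (B ∷ d)) → V* H (below M (chain A (B ∷ d)))
  below-∈V*-∷ {j} {H} M {A} {B} {d} len val@((fl , B⊂A) ∷ val-d) =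
    below-∈V* M (λ { refl → ⊂-irref refl B⊂A })
      (val-d , cong (2 +_) len , between ⊆-refl (proj₁ B⊂A))
      (skip val , cong (2 +_) len , between (proj₁ B⊂A) ⊆-refl)
      shrink
      (λ h → grow-top (h val-d (cong (2 +_) len) (between ⊆-refl (proj₁ B⊂A)))
                      (h (skip val) (cong (2 +_) len) (between (proj₁ B⊂A) ⊆-refl)))
      (s≤s z≤n) two₁ (clean⁺ M len (λ x∈ → ∈V⁻ M (proj₂ (x∈p∩q⁻ _ _ x∈)))
        (λ x∈ → let D , eq , _ = form x∈ in D , eq) two₁ (two val-d len form))
    where
    T = tops M (chain A (B ∷ d))

    interval : ∀ {l} → height l ≡ 2 + j → l ◁ chain A (B ∷ d) → ∃[ D ] l ≡ chain D d × B ⊆ D × D ⊆ A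
    interval {l} eq l◁ with tall⇒chain l eq
    ... | D , d′ , eq′ , refl with refl , B⊆D , D⊆A ← between⁻ (trans eq′ (sym len)) l◁ =
      D , refl , B⊆D , D⊆A

    form : ∀ {x} → x ∈ T → ∃[ D ] label M x ≡ chain D d × B ⊆ D × D ⊆ A
    form x∈ = let x∈A , x∈V = x∈p∩q⁻ _ _ x∈ in interval (∈V⁻ M x∈V) (∈below⁻ M x∈A)

    shrink : ∀ {a l′} → height a < 2 + j → a ◁ chain A (B ∷ d) →
      height l′ ≡ 2 + j → l′ ◁ chain A (B ∷ d) → a ◁ l′
    shrink {a} lt a◁ eq l′◁ with D , refl , B⊆D , D⊆A ← interval eq l′◁ =
      shrink-top B⊆D D⊆A (subst (height a <_) (cong (2 +_) (sym len)) lt) a◁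

    at : ∀ {l} → Valid l → (∀ {D} → B ⊆ D → D ⊆ A → l ◁ chain D d) → CommonAt M (height l) T l
    at {l} vl h = vl , refl , λ x∈ → let D , eq , B⊆D , D⊆A = form x∈ in
      subst (l ◁_) (sym eq) (h B⊆D D⊆A)

    two₁ : Two M 1 T
    two₁ with b , b′ , b≢b′ , A⊆ , A⊆′ ← Flat.blocks fl =
      block b , block b′ , (λ { refl → b≢b′ refl }) ,
      at block (λ _ D⊆A → above-top (⊆-trans D⊆A A⊆)) ,
      at block (λ _ D⊆A → above-top (⊆-trans D⊆A A⊆′))

    -- What lies under the lower end `B` is shared by the whole interval: two elements of `B` if `d`
    -- is empty, otherwise the chains ending in `B` and in the next set `R`.
    two : ∀ {d} → Valid (chain B d) → length d ≡ j →
      (∀ {x} → x ∈ T → ∃[ D ] label M x ≡ chain D d × B ⊆ D × D ⊆ A) → Two M (rung (length d)) T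
    two {d} val-d len form = go val-d
      where
      at′ : ∀ {l} → Valid l → (∀ {D} → B ⊆ D → l ◁ chain D d) → CommonAt M (height l) T l
      at′ {l} vl h = vl , refl , λ x∈ → let D , eq , B⊆D , _ = form x∈ in
        subst (l ◁_) (sym eq) (h B⊆D)

      go : Valid (chain B d) → Two M (rung (length d)) T
      go [ fl ] with v , v′ , v≢v′ , v∈ , v′∈ ← two⁻ (Flat.size fl) =
        point v , point v′ , (λ { refl → v≢v′ refl }) ,
        at′ point (λ B⊆D → in-bottom (B⊆D v∈)) , at′ point (λ B⊆D → in-bottom (B⊆D v′∈))
      go val@((_ , R⊂B) ∷ val-r) =
        _ , _ , (λ { refl → ⊂-irref refl R⊂B }) ,
        at′ val-r (λ B⊆D → between ⊆-refl (⊆-trans (proj₁ R⊂B) B⊆D)) ,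
        at′ (skip val) (λ B⊆D → between (proj₁ R⊂B) B⊆D)

  -- Covering the members of `V*` by chains.

  span : Label n m → Subset n
  span (point v)   = ⁅ v ⁆
  span (block b)   = K b
  span (chain A _) = A

  -- `S` consists of blocks, and its common neighbours are the points of their intersection `inf`.
  -- Two of these give its size, and `x` and `y` give two blocks around it.
  cover-[] : ∀ {H : Partite 2} (M : Model H) {S x y} → Top M S → x ≢ y → x ∈ S → y ∈ S →
    2 ≤ ∣ ⋂[ S ] (N H) ∣ →
    ∃[ A ] ∃[ c ] Valid (chain A c) × length c ≡ 0
      × (∀ {x} → x ∈ S → label M x ◁ chain A c)
      × (∀ {a} → Valid a → Common M S a → a ◁ chain A c)
  cover-[] {H} M {S} {x} {y} top x≢y x∈S y∈S 2≤N =
    inf , [] , [ flat size (inf-closed closed) blocks ] , refl , S◁ , N◁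
    where
    open Envelope S (span ∘ label M)

    form : ∀ {z} → z ∈ S → ∃[ b ] label M z ≡ block b
    form {z} z∈S = block-form (label M z) (top z∈S)
      where
      block-form : ∀ l → height l ≡ 1 → ∃[ b ] l ≡ block b
      block-form (block b) refl = b , refl

    in-span : ∀ {v l b} → l ≡ block b → point v ◁ l → v ∈ span l
    in-span refl (in-block v∈) = v∈

    point-form : ∀ {a l b} → l ≡ block b → a ◁ l → ∃[ v ] a ≡ point v
    point-form refl (in-block {v = v} _) = v , refl

    common⇒point : ∀ {a} → Common M S a → ∃[ v ] a ≡ point v × v ∈ inf
    common⇒point {a} com with v , refl ← point-form (proj₂ (form x∈S)) (com x∈S) =
      v , refl , ∈⋂⁺ (_∈? S) (λ z∈S → in-span (proj₂ (form z∈S)) (com z∈S))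

    N◁ : ∀ {a} → Valid a → Common M S a → a ◁ chain inf []
    N◁ _ com with v , refl , v∈ ← common⇒point com = in-bottom v∈

    size : 2 ≤ ∣ inf ∣
    size with u , u′ , u≢u′ , u∈ , u′∈ ← two⁻ 2≤N
      with v , eq , v∈ ← common⇒point (⋂N⁻ M top u∈) | v′ , eq′ , v′∈ ← common⇒point (⋂N⁻ M top u′∈)
      = two⁺ (λ { refl → u≢u′ (injective M (trans eq (sym eq′))) }) v∈ v′∈

    closed : ∀ {z} → z ∈ S → Closed (span (label M z))
    closed {z} z∈S h with label M z | form z∈S
    ... | _ | b , refl = h b ⊆-refl

    inf⊆K : ∀ {z b} → z ∈ S → label M z ≡ block b → inf ⊆ K b
    inf⊆K z∈S eq v∈ = subst (λ l → _ ∈ span l) eq (inf⊆ z∈S v∈)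

    blocks : ∃[ b ] ∃[ b′ ] b ≢ b′ × inf ⊆ K b × inf ⊆ K b′
    blocks with b , eq ← form x∈S | b′ , eq′ ← form y∈S =
      b , b′ , (λ { refl → x≢y (injective M (trans eq (sym eq′))) }) , inf⊆K x∈S eq , inf⊆K y∈S eq′

    S◁ : ∀ {z} → z ∈ S → label M z ◁ chain inf []
    S◁ z∈S with b , eq ← form z∈S = subst (_◁ chain inf []) (sym eq) (above-top (inf⊆K z∈S eq))

  module _ {H : Partite (3 + j)} (M : Model H) {S x y d}
    (x≢y : x ≢ y) (x∈S : x ∈ S) (y∈S : y ∈ S) (tails : Tails M d S)
    (two₁ : Two M 1 S) (two : Two M (rung (length d)) S)
    where

    open Envelope S (span ∘ label M)

    private
      D : Fin (order H) → Subset n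
      D = span ∘ label M

      form : ∀ {z} → z ∈ S → label M z ≡ chain (D z) d
      form z∈S with _ , eq ← tails z∈S = trans eq (cong (λ l → chain (span l) d) (sym eq))

      valid-form : ∀ {z} → z ∈ S → Valid (chain (D z) d)
      valid-form z∈S = subst Valid (form z∈S) (valid M _)

      common-form : ∀ {a z} → Common M S a → z ∈ S → a ◁ chain (D z) d
      common-form com z∈S = subst (_ ◁_) (form z∈S) (com z∈S)

      inf⊂sup : inf ⊂ sup
      -- Equality would squeeze all `D z` together, but distinct vertices with the same tail have
      -- distinct largest sets.
      inf⊂sup = ⊆∧≢⇒⊂ (⊆-trans (inf⊆ x∈S) (⊆sup x∈S)) λ inf≡sup →
        x≢y (injective M (trans (form x∈S) (trans
          (cong (λ A → chain A d) (trans (D≡inf inf≡sup x∈S) (sym (D≡inf inf≡sup y∈S))))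
          (sym (form y∈S)))))
        where
        D≡inf : ∀ {z} → inf ≡ sup → z ∈ S → D z ≡ inf
        D≡inf inf≡sup z∈S = ⊆-antisym (subst (_ ⊆_) (sym inf≡sup) (⊆sup z∈S)) (inf⊆ z∈S)

      -- A block containing every `D z` contains the closure of their union; the condition on level
      -- 1 supplies two such blocks.
      sup-blocks : Two M 1 S → ∃[ b ] ∃[ b′ ] b ≢ b′ × sup ⊆ K b × sup ⊆ K b′
      sup-blocks (block b , block b′ , l≢l′ , (_ , refl , com) , (_ , refl , com′)) =
        b , b′ , l≢l′ ∘ cong block , sup⊆K com , sup⊆K com′
        where
        sup⊆K : ∀ {b} → Common M S (block b) → sup ⊆ K b
        sup⊆K com = sup⊆ λ z∈S → case common-form com z∈S of λ { (above-top D⊆) → D⊆ }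

      flat-inf : (∀ {z} → z ∈ S → Flat (D z)) → 2 ≤ ∣ inf ∣ → Flat inf
      flat-inf flats size with b , b′ , b≢b′ , D⊆ , D⊆′ ← Flat.blocks (flats x∈S) =
        flat size (inf-closed (Flat.closed ∘ flats))
          (b , b′ , b≢b′ , ⊆-trans (inf⊆ x∈S) D⊆ , ⊆-trans (inf⊆ x∈S) D⊆′)

      -- Two common neighbours on the rung give room below `inf`: two points in it if `d` is empty,
      -- otherwise two distinct sets between `R` and `inf`, so that `R ⊂ inf`.
      chain-inf : ∀ {d} → (∀ {z} → z ∈ S → Valid (chain (D z) d)) →
        (∀ {a z} → Common M S a → z ∈ S → a ◁ chain (D z) d) →
        Two M (rung (length d)) S → Valid (chain inf d)
      chain-inf {[]} valid-form common-form
        (point v , point v′ , l≢l′ , (_ , refl , com) , (_ , refl , com′)) =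
        [ flat-inf (top-flat ∘ valid-form) (two⁺ (l≢l′ ∘ cong point) (∈inf com) (∈inf com′)) ]
        where
        ∈inf : ∀ {v} → Common M S (point v) → v ∈ inf
        ∈inf com = ∈⋂⁺ (_∈? S) λ z∈S → case common-form com z∈S of λ { (in-bottom v∈) → v∈ }
      chain-inf {R ∷ r} valid-form common-form (l , l′ , l≢l′ , (_ , eq , com) , (_ , eq′ , com′))
        with tall⇒chain l eq | tall⇒chain l′ eq′ | valid-form x∈S
      ... | A , a , len , refl | A′ , a′ , len′ , refl | _ ∷ val =
        ( flat-inf (top-flat ∘ valid-form)
            (≤-trans (Flat.size (top-flat val)) (p⊆q⇒∣p∣≤∣q∣ (proj₁ R⊂inf)))
        , R⊂inf ) ∷ val
        where
        bounds : ∀ {A a} → length a ≡ length r → Common M S (chain A a) → a ≡ r × R ⊆ A × A ⊆ inf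
        bounds len com with refl , R⊆A , _ ← between⁻ len (common-form com x∈S) =
          refl , R⊆A , ⊆inf λ z∈S → proj₂ (proj₂ (between⁻ refl (common-form com z∈S)))

        R⊂inf : R ⊂ inf
        R⊂inf with refl , R⊆A , A⊆inf ← bounds len com | refl , R⊆A′ , A′⊆inf ← bounds len′ com′ =
          ⊆∧≢⇒⊂ (⊆-trans R⊆A A⊆inf) λ { refl →
            l≢l′ (cong (λ A → chain A r) (⊆-antisym (⊆-trans A⊆inf R⊆A′) (⊆-trans A′⊆inf R⊆A))) }

    -- All `D z` lie between `inf` and `sup`, and since these bounds are tightest, every common
    -- neighbour is kept as well.
    cover-∷ : ∃[ A ] ∃[ c ] Valid (chain A c) × length c ≡ 1 + length d
      × (∀ {x} → x ∈ S → label M x ◁ chain A c)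
      × (∀ {a} → Valid a → Common M S a → a ◁ chain A c)
    cover-∷ = sup , inf ∷ d , (flat-sup , inf⊂sup) ∷ val-inf , refl
      , (λ z∈S → subst (_◁ chain sup (inf ∷ d)) (sym (form z∈S)) (between (inf⊆ z∈S) (⊆sup z∈S)))
      , N◁
      where
      val-inf : Valid (chain inf d)
      val-inf = chain-inf valid-form common-form two

      flat-sup : Flat sup
      flat-sup = flat (≤-trans (Flat.size (top-flat val-inf)) (p⊆q⇒∣p∣≤∣q∣ (proj₁ inf⊂sup)))
                      sup-closed (sup-blocks two₁)

      N◁ : ∀ {a} → Valid a → Common M S a → a ◁ chain sup (inf ∷ d)
      N◁ {a} _ com = go a (common-form com)
        where
        go : ∀ {d} a → (∀ {z} → z ∈ S → a ◁ chain (D z) d) → a ◁ chain sup (inf ∷ d)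
        go {[]} (point v) h = in-bottom (∈⋂⁺ (_∈? S) λ z∈S → case h z∈S of λ { (in-bottom v∈) → v∈ })
        go {_ ∷ _} (point v) h with in-bottom v∈ ← h x∈S = in-bottom v∈
        go (block b) h = above-top (sup⊆ λ z∈S → case h z∈S of λ { (above-top D⊆) → D⊆ })
        go {[]} (chain _ _) h with () ← h x∈S
        go {_ ∷ _} (chain _ _) h with h x∈S
        -- A set contained in every `D z` is contained in `inf`, which now bounds it from above.
        ... | between R⊆ _ = deeper (between R⊆ (⊆inf λ z∈S → proj₂ (proj₂ (between⁻ refl (h z∈S)))))
        ... | deeper a◁ = deeper (deeper a◁)

  below-chain-∈V* : ∀ {H : Partite (2 + j)} (M : Model H) {A c} → Valid (chain A c) → length c ≡ j →
    V* H (below M (chain A c))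
  below-chain-∈V* {zero}  M {c = []}    [ fl ] _   = below-∈V*-[] M fl
  below-chain-∈V* {suc j} M {c = _ ∷ _} val    len = below-∈V*-∷ M (suc-injective len) val

  cover : ∀ {H : Partite (2 + j)} (M : Model H) {X} → V* H X →
    ∃[ A ] ∃[ c ] Valid (chain A c) × length c ≡ j × X ⊆ below M (chain A c)
  cover {zero}  M X∈V* = V*-⊆below M X∈V* λ top x≢y x∈S y∈S 2≤N _ → cover-[] M top x≢y x∈S y∈S 2≤N
  cover {suc j} M X∈V* = V*-⊆below M X∈V* λ top x≢y x∈S y∈S _ clean →
    case clean⁻ M top x∈S clean of λ { (d , refl , tails , two₁ , two) →
      cover-∷ M x≢y x∈S y∈S tails two₁ two }

  -- The model of the clean-factor graph.

  module _ {j} {H : Partite (2 + j)} (M : Model H) where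

    private
      Xs = maximals (V*? H)

      -- The covering set is itself in `V*`, so a maximal `X` equals it.
      maximal⇒below : ∀ {X} → Maximal (V* H) X →
        ∃[ A ] ∃[ c ] Valid (chain A c) × length c ≡ j × X ≡ below M (chain A c)
      maximal⇒below max@(X∈V* , _) =
        let A , c , val , len , X⊆ = cover M X∈V*
        in A , c , val , len , maximal-⊆ max (below-chain-∈V* M val len) X⊆

      represent : ∀ i →
        ∃[ A ] ∃[ c ] Valid (chain A c) × length c ≡ j × lookup Xs i ≡ below M (chain A c)
      represent i = maximal⇒below (lookup-maximals (V*? H) i)

      new : Fin (length Xs) → Label n m
      new i = let A , c , _ = represent i in chain A c

      new-valid : ∀ i → Valid (new i)
      new-valid i = let _ , _ , val , _ = represent i in val

      new-height : ∀ i → height (new i) ≡ 2 + j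
      new-height i = let _ , _ , _ , len , _ = represent i in cong (2 +_) len

      new-below : ∀ i → lookup Xs i ≡ below M (new i)
      new-below i = let _ , _ , _ , _ , eq = represent i in eq

      new-injective : ∀ {i i′} → new i ≡ new i′ → i ≡ i′
      new-injective {i} {i′} eq = lookup-injective (maximals-unique (V*? H)) i i′
        (trans (new-below i) (trans (cong (below M) eq) (sym (new-below i′))))

      -- A larger member of `V*` would lie in the neighbourhood of another chain, against the
      -- antichain property.
      below-maximal : ∀ {A c} → Valid (chain A c) → length c ≡ j → Maximal (V* H) (below M (chain A c))
      below-maximal val len = below-chain-∈V* M val len , λ (Y , Y∈V* , below⊂Y) →
        let A′ , c′ , val′ , len′ , Y⊆ = cover M Y∈V*
            below⊂ = ⊂-⊆-trans below⊂Y Y⊆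
            A≡A′ , c≡c′ = below⊆⇒≡ M val val′ len len′ (proj₁ below⊂)
        in ⊂-irref (cong₂ (λ A c → below M (chain A c)) A≡A′ c≡c′) below⊂

      new-vertex : ∀ {l} → Valid l → height l ≡ 2 + j → ∃[ i ] new i ≡ l
      new-vertex {chain A c} val eq =
        index below∈Xs ,
        -- The label at this position was chosen by `represent`; as it has the same `below`, it is
        -- the given chain.
        (let A≡ , c≡ = below⊆⇒≡ M (new-valid _) val (suc-injective (suc-injective (new-height _))) len
                         (⊆-reflexive (trans (sym (new-below _)) (sym (lookup-index below∈Xs))))
         in cong₂ chain A≡ c≡)
        where
        len : length c ≡ j
        len = suc-injective (suc-injective eq)

        below∈Xs : below M (chain A c) List.∈ Xs
        below∈Xs = ∈-filter⁺ (maximal? (V*? H)) (∈-allSubsets _) (below-maximal val len)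

    cleanFactor-model : Model (cleanFactor H)
    cleanFactor-model =
      addLevel-model H M Xs new new-injective new-valid new-height new-vertex new-below

    -- A new vertex yields a chain of `1 + j` sets, whose largest set has more than `j` of the `n`
    -- vertices.
    effective⇒j<n : CleanFactorEffective H → j < n
    effective⇒j<n eff =
      let _ , X∈V* = maximals-inhabited (V*? H) eff
          A , _ , val , len , _ = cover M X∈V*
      in subst (_< n) len (<-≤-trans (length<size val) (∣p∣≤n A))

-- The series generated by a graph.

module _ {n} (G : Graph n) where

  private
    cliques : List (Subset n)
    cliques = maximals (clique? G)

  open Labels (lookup cliques)
  open Model

  vertexLevel-model : Model (vertexLevel G)
  vertexLevel-model = record
    { label     = point
    ; injective = λ { refl → refl }
    ; valid     = λ _ → point
    ; vertex    = λ { {point v} _ _ → v , refl ; {block _} _ (s≤s ()) ; {chain _ _} _ (s≤s ()) }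
    ; level≡    = λ _ → refl
    ; adj⁺      = λ ()
    ; adj⁻      = λ ()
    }

  incidence-model : Model (incidence G)
  incidence-model = addLevel-model (vertexLevel G) vertexLevel-model cliques
    block (λ { refl → refl }) (λ _ → block) (λ _ → refl)
    (λ { {block b} _ _ → b , refl })
    (λ b → ⊆-antisym
      (λ v∈ → ∈below⁺ vertexLevel-model {l = block b} (in-block v∈))
      (λ v∈ → case ∈below⁻ vertexLevel-model {l = block b} v∈ of λ { (in-block v∈) → v∈ }))

  series-suc : ∀ {i} {H : Partite (2 + i)} → cleanFactorSeries G (1 + i) ≡ just H →
    CleanFactorEffective H → cleanFactorSeries G (2 + i) ≡ just (cleanFactor H)
  series-suc {H = H} eq eff = trans (cong (_>>= nextGraph) eq)
    (cong (λ b → when b (cleanFactor H)) (dec-true (cleanFactorEffective? H) eff))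

  -- Every effective step has `i < n`, so with `n ≤ fuel + i` maintained, the step at which `fuel`
  -- is exhausted cannot be effective.
  terminates : ∀ fuel {i} {H : Partite (2 + i)} → Model H → n ≤ fuel + i →
    cleanFactorSeries G (1 + i) ≡ just H →
    ∃[ i ] Σ[ H ∈ Partite (2 + i) ] (cleanFactorSeries G (1 + i) ≡ just H × ¬ CleanFactorEffective H)
  terminates zero {i} {H} M n≤i eq = i , H , eq , λ eff → ≤⇒≯ n≤i (effective⇒j<n M eff)
  terminates (suc fuel) {i} {H} M n≤ eq = case cleanFactorEffective? H of λ
    { (yes eff) → terminates fuel {suc i} {cleanFactor H} (cleanFactor-model {i} {H} M)
                    (subst (n ≤_) (sym (+-suc fuel i)) n≤) (series-suc {i} {H} eq eff)
    ; (no ¬eff) → i , H , eq , ¬eff }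

theorem2 : ∀ {n} (G : Graph n) →
    ∃[ i ] Σ[ H ∈ Partite (2 + i) ]
    (cleanFactorSeries G (1 + i) ≡ just H × ¬ CleanFactorEffective H)
theorem2 {n} G = terminates G n {0} {incidence G} (incidence-model G) (m≤m+n n 0) refl
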